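{- Let $G$ be a minimally dependent oriented hypergraph. If $G'$ is obtained from $G$ by a $2$-vertex-contraction, then $G'$ is minimally dependent.
   Context: An oriented hypergraph has disjoint finite sets of vertices and edges, incidences $(v,e,k)$ with $1\le k\le\iota(v,e)$, and an orientation $\sigma$ assigning $\pm1$ to each incidence. The degree of a vertex is the number of incidences containing it. The incidence matrix has rows indexed by vertices, columns by edges, entries $\sum_k\sigma(v,e,k)$; minimally dependent means the columns are linearly dependent while every proper subfamily of columns is independent. Edge-switching an edge negates $\sigma$ on all incidences containing it. A vertex $v$ of degree $2$ whose two incidences lie in distinct edges $e_1,e_2$ is compatibly oriented if the product of the orientations of these two incidences is $-1$. The $2$-vertex-contraction at such a $v$: if $v$ is not compatibly oriented, first switch one of $e_1,e_2$; then replace $e_1,e_2$ by a single new edge carrying all incidences of $e_1$ and $e_2$ other than those at $v$ (with their orientations), and delete $v$. -}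

module Defs where

open import Data.Nat using (ℕ; zero; suc)
import Data.Nat as ℕ
open import Data.Integer using (ℤ; 0ℤ; 1ℤ; -1ℤ)
import Data.Integer as ℤ
open import Data.Fin using (Fin; zero; suc; punchIn; splitAt; _≟_)
open import Data.Fin.Subset using (Subset; _∉_)
open import Data.Sign using (Sign; opposite)
import Data.Sign as Sign
open import Data.Sum using (inj₁; inj₂)
open import Data.Product using (Σ; ∃; _×_; _,_)
open import Data.Bool using (Bool; true; false)
open import Relation.Nullary using (¬_; Dec; yes; no)
open import Relation.Binary.PropositionalEquality using (_≡_; _≢_; subst; sym)

-- Finite sums indexed by Fin k.
∑ℕ : (k : ℕ) → (Fin k → ℕ) → ℕ
∑ℕ zero    f = 0
∑ℕ (suc k) f = f zero ℕ.+ ∑ℕ k (λ i → f (suc i))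

∑ℤ : (k : ℕ) → (Fin k → ℤ) → ℤ
∑ℤ zero    f = 0ℤ
∑ℤ (suc k) f = f zero ℤ.+ ∑ℤ k (λ i → f (suc i))

signℤ : Sign → ℤ
signℤ Sign.+ = 1ℤ
signℤ Sign.- = -1ℤ

-- An oriented hypergraph with vertex set Fin n and edge set Fin m.
-- ι v e is the multiplicity of v in e; the incidences are (v , e , k)
-- with k : Fin (ι v e) (i.e. k = 1 .. ι(v,e)); σ is the orientation.
record OHG (n m : ℕ) : Set where
  field
    ι : Fin n → Fin m → ℕ
    σ : (v : Fin n) (e : Fin m) → Fin (ι v e) → Sign
open OHG public

-- degree = number of incidences containing v
degree : ∀ {n m} → OHG n m → Fin n → ℕ
degree {m = m} G v = ∑ℕ m (λ e → ι G v e)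

-- incidence matrix entry  ∑_k σ(v,e,k)
incMat : ∀ {n m} → OHG n m → Fin n → Fin m → ℤ
incMat G v e = ∑ℤ (ι G v e) (λ k → signℤ (σ G v e k))

-- the linear combination ∑_e c_e · (column e) is the zero vector
CombZero : ∀ {n m} → OHG n m → (Fin m → ℤ) → Set
CombZero {n} {m} G c = ∀ (v : Fin n) → ∑ℤ m (λ e → c e ℤ.* incMat G v e) ≡ 0ℤ

-- the columns are linearly dependent (over ℤ, equivalently over ℚ or ℝ)
ColumnsDependent : ∀ {n m} → OHG n m → Set
ColumnsDependent {n} {m} G =
  Σ (Fin m → ℤ) λ c → (∃ λ e → c e ≢ 0ℤ) × CombZero G c

-- the subfamily of columns indexed by S is linearly independent
IndependentOn : ∀ {n m} → OHG n m → Subset m → Set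
IndependentOn {n} {m} G S =
  ∀ (c : Fin m → ℤ) → (∀ e → e ∉ S → c e ≡ 0ℤ) → CombZero G c → ∀ e → c e ≡ 0ℤ

MinimallyDependent : ∀ {n m} → OHG n m → Set
MinimallyDependent {n} {m} G =
  ColumnsDependent G × (∀ (S : Subset m) → (∃ λ e → e ∉ S) → IndependentOn G S)

-- edge-switching the edge s
switchEdge : ∀ {n m} → OHG n m → Fin m → OHG n m
switchEdge G s = record
  { ι = ι G
  ; σ = λ v e k → sw (e ≟ s) (σ G v e k) }
  where
    sw : ∀ {A : Set} → Dec A → Sign → Sign
    sw (yes _) x = opposite x
    sw (no _)  x = x

-- The unique incidence of v in an edge e with ι v e ≡ 1.
theInc : ∀ {n m} (G : OHG n m) (v : Fin n) (e : Fin m) → ι G v e ≡ 1 → Fin (ι G v e)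
theInc G v e h = subst Fin (sym h) zero

-- v (of degree 2, one incidence in e₁, one in e₂, e₁ ≠ e₂) is compatibly oriented
CompatiblyOriented : ∀ {n m} (G : OHG n m) (v : Fin n) (e₁ e₂ : Fin m)
  → ι G v e₁ ≡ 1 → ι G v e₂ ≡ 1 → Set
CompatiblyOriented G v e₁ e₂ h₁ h₂ =
  σ G v e₁ (theInc G v e₁ h₁) Sign.* σ G v e₂ (theInc G v e₂ h₂) ≡ Sign.-

-- Replace e₁,e₂ by one edge carrying their incidences except those at v,
-- and delete v.  New vertices: Fin n via punchIn v; new edges: Fin m via
-- punchIn e₂, where the old position of e₁ becomes the merged edge
-- (its incidences: first those of e₁, then those of e₂).
merge : ∀ {n m} → OHG (suc n) (suc m) → Fin (suc n) → (e₁ e₂ : Fin (suc m)) → OHG n m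
merge {n} {m} G v e₁ e₂ = record { ι = ι' ; σ = σ' }
  where
    ιA : Fin n → (f : Fin m) → Dec (punchIn e₂ f ≡ e₁) → ℕ
    ιA w f (yes _) = ι G (punchIn v w) e₁ ℕ.+ ι G (punchIn v w) e₂
    ιA w f (no _)  = ι G (punchIn v w) (punchIn e₂ f)
    σA : (w : Fin n) (f : Fin m) (d : Dec (punchIn e₂ f ≡ e₁)) → Fin (ιA w f d) → Sign
    σA w f (yes _) k with splitAt (ι G (punchIn v w) e₁) k
    ... | inj₁ k₁ = σ G (punchIn v w) e₁ k₁
    ... | inj₂ k₂ = σ G (punchIn v w) e₂ k₂
    σA w f (no _) k = σ G (punchIn v w) (punchIn e₂ f) k
    ι' : Fin n → Fin m → ℕ
    ι' w f = ιA w f (punchIn e₂ f ≟ e₁)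
    σ' : (w : Fin n) (f : Fin m) → Fin (ι' w f) → Sign
    σ' w f = σA w f (punchIn e₂ f ≟ e₁)

-- switch beforehand if needed; the Bool chooses which of e₁ (true) / e₂ (false)
-- is switched when v is not compatibly oriented.
preSwitch : ∀ {n m} (G : OHG n m) (v : Fin n) (e₁ e₂ : Fin m)
  (h₁ : ι G v e₁ ≡ 1) (h₂ : ι G v e₂ ≡ 1) → Bool
  → Dec (CompatiblyOriented G v e₁ e₂ h₁ h₂) → OHG n m
preSwitch G v e₁ e₂ h₁ h₂ b     (yes _) = G
preSwitch G v e₁ e₂ h₁ h₂ true  (no _)  = switchEdge G e₁
preSwitch G v e₁ e₂ h₁ h₂ false (no _)  = switchEdge G e₂

twoVertexContraction : ∀ {n m} (G : OHG (suc n) (suc m)) (v : Fin (suc n))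
  (e₁ e₂ : Fin (suc m)) (h₁ : ι G v e₁ ≡ 1) (h₂ : ι G v e₂ ≡ 1) → Bool → OHG n m
twoVertexContraction G v e₁ e₂ h₁ h₂ b =
  merge (preSwitch G v e₁ e₂ h₁ h₂ b
           (σ G v e₁ (theInc G v e₁ h₁) Sign.* σ G v e₂ (theInc G v e₂ h₂) Sign.≟ Sign.-))
        v e₁ e₂

-- Let M be the incidence matrix. After the optional switching (which negates one column and so
-- preserves minimal dependence), the degree-2 vertex v gives M a row whose only nonzero entries
-- are a at e₁ and −a at e₂. Every kernel vector c of M therefore has c e₁ = c e₂, and dropping
-- the e₂-coordinate maps ker M onto the kernel of the contracted matrix (merge columns e₁, e₂,
-- delete row v), with inverse "duplicate the merged coordinate". Both maps preserve being nonzero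
-- and vanishing at some column, and minimal dependence says exactly that a nonzero kernel vector
-- exists and every kernel vector vanishing at some column is zero.
module Submission where

open import Defs
open import Data.Bool using (Bool; true; false)
open import Data.Fin using (Fin; zero; suc; punchIn; punchOut; splitAt; _≟_)
open import Data.Fin.Properties using (punchIn-punchOut; punchInᵢ≢i; punchIn-injective; punchOut-injective)
open import Data.Fin.Subset using (∁; ⁅_⁆)
open import Data.Fin.Subset.Properties using (x∈p⇒x∉∁p; x∉∁p⇒x∈p; x∈⁅x⁆; x∈⁅y⁆⇒x≡y)
open import Data.Integer using (ℤ; 0ℤ; 1ℤ; _+_; _*_; -_; _-_)
import Data.Integer.Properties as ℤP
open import Data.Integer.Solver using (module +-*-Solver)
open import Data.Nat using (ℕ; zero; suc; _≤_)
import Data.Nat as ℕ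
import Data.Nat.Properties as ℕP
open import Data.Product using (∃; _,_; proj₁; proj₂)
open import Data.Sign using (Sign; opposite)
import Data.Sign as Sign
import Data.Sign.Properties as SignP
open import Data.Sum using (_⊎_; inj₁; inj₂; [_,_]′; map₁)
open import Data.Vec.Functional using (Vector; removeAt; insertAt)
open import Data.Vec.Functional.Properties using (insertAt-lookup; insertAt-punchIn; insertAt-removeAt)
open import Function using (_∘_)
open import Relation.Binary.PropositionalEquality
open import Relation.Nullary using (¬_; yes; no; contradiction)

open import Algebra.Properties.Semiring.Sum ℤP.+-*-semiring
  using (sum; sum-remove; sum-cong-≗; sum-replicate-zero; *-distribˡ-sum)
import Algebra.Properties.CommutativeMonoid.Sum ℕP.+-0-commutativeMonoid as ℕΣ
open +-*-Solver using (solve; _:*_; _:+_; _:-_; :-_; _:=_)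

private variable
  n m : ℕ

∑ℤ≡sum : ∀ k (f : Fin k → ℤ) → ∑ℤ k f ≡ sum f
∑ℤ≡sum zero    f = refl
∑ℤ≡sum (suc k) f = cong (f zero +_) (∑ℤ≡sum k (f ∘ suc))

∑ℕ≡sum : ∀ k (f : Fin k → ℕ) → ∑ℕ k f ≡ ℕΣ.sum f
∑ℕ≡sum zero    f = refl
∑ℕ≡sum (suc k) f = cong (f zero ℕ.+_) (∑ℕ≡sum k (f ∘ suc))

sum-splitAt : ∀ a b (g : Fin a ⊎ Fin b → ℤ) → sum (g ∘ splitAt a) ≡ sum (g ∘ inj₁) + sum (g ∘ inj₂)
sum-splitAt zero    b g = sym (ℤP.+-identityˡ (sum (g ∘ inj₂)))
sum-splitAt (suc a) b g = begin
  g (inj₁ zero) + sum (g ∘ map₁ suc ∘ splitAt a)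
    ≡⟨ cong (g (inj₁ zero) +_) (sum-splitAt a b (g ∘ map₁ suc)) ⟩
  g (inj₁ zero) + (sum (g ∘ inj₁ ∘ suc) + sum (g ∘ inj₂))
    ≡⟨ ℤP.+-assoc (g (inj₁ zero)) (sum (g ∘ inj₁ ∘ suc)) (sum (g ∘ inj₂)) ⟨
  sum (g ∘ inj₁) + sum (g ∘ inj₂) ∎
  where open ≡-Reasoning

sum-single : (f : Vector ℤ n) (i : Fin n) → (∀ j → j ≢ i → f j ≡ 0ℤ) → sum f ≡ f i
sum-single {suc n} f i zero-off = begin
  sum f                      ≡⟨ sum-remove {i = i} f ⟩
  f i + sum (removeAt f i)   ≡⟨ cong (f i +_) (sum-cong-≗ λ j → zero-off (punchIn i j) (punchInᵢ≢i i j)) ⟩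
  f i + sum {n} (λ _ → 0ℤ)   ≡⟨ cong (f i +_) (sum-replicate-zero n) ⟩
  f i + 0ℤ                   ≡⟨ ℤP.+-identityʳ (f i) ⟩
  f i                        ∎
  where open ≡-Reasoning

sum-bumpAt : (f g : Vector ℤ n) (i : Fin n) (d : ℤ) → f i ≡ g i + d → (∀ j → j ≢ i → f j ≡ g j) →
             sum f ≡ sum g + d
sum-bumpAt {suc n} f g i d at-i off-i = begin
  sum f                            ≡⟨ sum-remove {i = i} f ⟩
  f i + sum (removeAt f i)         ≡⟨ cong₂ _+_ at-i (sum-cong-≗ λ j → off-i (punchIn i j) (punchInᵢ≢i i j)) ⟩
  g i + d + sum (removeAt g i)     ≡⟨ solve 3 (λ x y z → x :+ y :+ z := x :+ z :+ y) refl (g i) d (sum (removeAt g i)) ⟩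
  g i + sum (removeAt g i) + d     ≡⟨ cong (_+ d) (sum-remove {i = i} g) ⟨
  sum g + d                        ∎
  where open ≡-Reasoning

term≤sum : (h : Vector ℕ n) (i : Fin n) → h i ≤ ℕΣ.sum h
term≤sum {suc n} h i = subst (h i ≤_) (sym (ℕΣ.sum-remove {i = i} h)) (ℕP.m≤m+n (h i) _)

pair≤sum : (h : Vector ℕ n) {i j : Fin n} → i ≢ j → h i ℕ.+ h j ≤ ℕΣ.sum h
pair≤sum {suc n} h {i} {j} i≢j = begin
  h i ℕ.+ h j                          ≡⟨ cong (λ x → h i ℕ.+ h x) (punchIn-punchOut i≢j) ⟨
  h i ℕ.+ removeAt h i (punchOut i≢j)  ≤⟨ ℕP.+-monoʳ-≤ (h i) (term≤sum (removeAt h i) (punchOut i≢j)) ⟩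
  h i ℕ.+ ℕΣ.sum (removeAt h i)        ≡⟨ ℕΣ.sum-remove {i = i} h ⟨
  ℕΣ.sum h                             ∎
  where open ℕP.≤-Reasoning

sum≡pair⇒others≡0 : (h : Vector ℕ n) {i j k : Fin n} → i ≢ j → k ≢ i → k ≢ j →
                    ℕΣ.sum h ≡ h i ℕ.+ h j → h k ≡ 0
sum≡pair⇒others≡0 {suc n} h {i} {j} {k} i≢j k≢i k≢j sum≡pair =
  ℕP.n≤0⇒n≡0 (ℕP.+-cancelʳ-≤ (h i ℕ.+ h j) (h k) 0 (begin
    h k ℕ.+ (h i ℕ.+ h j)
      ≡⟨ cong₂ (λ x y → h k ℕ.+ (h x ℕ.+ h y)) (punchIn-punchOut k≢i) (punchIn-punchOut k≢j) ⟨
    h k ℕ.+ (removeAt h k (punchOut k≢i) ℕ.+ removeAt h k (punchOut k≢j))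
      ≤⟨ ℕP.+-monoʳ-≤ (h k) (pair≤sum (removeAt h k) (i≢j ∘ punchOut-injective k≢i k≢j)) ⟩
    h k ℕ.+ ℕΣ.sum (removeAt h k)
      ≡⟨ ℕΣ.sum-remove {i = k} h ⟨
    ℕΣ.sum h
      ≡⟨ sum≡pair ⟩
    h i ℕ.+ h j ∎))
  where open ℕP.≤-Reasoning

signℤ-* : ∀ x y → signℤ (x Sign.* y) ≡ signℤ x * signℤ y
signℤ-* Sign.+ Sign.+ = refl
signℤ-* Sign.+ Sign.- = refl
signℤ-* Sign.- Sign.+ = refl
signℤ-* Sign.- Sign.- = refl

signℤ-cancel : ∀ x a → signℤ x * (signℤ x * a) ≡ a
signℤ-cancel x a = begin
  signℤ x * (signℤ x * a)  ≡⟨ ℤP.*-assoc (signℤ x) (signℤ x) a ⟨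
  signℤ x * signℤ x * a    ≡⟨ cong (_* a) (signℤ-* x x) ⟨
  signℤ (x Sign.* x) * a   ≡⟨ cong (λ y → signℤ y * a) (SignP.s*s≡+ x) ⟩
  1ℤ * a                   ≡⟨ ℤP.*-identityˡ a ⟩
  a                        ∎
  where open ≡-Reasoning

signℤ≢0 : ∀ x → signℤ x ≢ 0ℤ
signℤ≢0 Sign.+ ()
signℤ≢0 Sign.- ()

*≡-⇒signℤ-opposite : ∀ {x y} → x Sign.* y ≡ Sign.- → signℤ y ≡ - signℤ x
*≡-⇒signℤ-opposite {Sign.+} {Sign.-} _ = refl
*≡-⇒signℤ-opposite {Sign.-} {Sign.+} _ = refl

*≢-⇒≡ : ∀ {x y} → x Sign.* y ≢ Sign.- → x ≡ y
*≢-⇒≡ {Sign.+} {Sign.+} _      = refl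
*≢-⇒≡ {Sign.-} {Sign.-} _      = refl
*≢-⇒≡ {Sign.+} {Sign.-} x*y≢- = contradiction refl x*y≢-
*≢-⇒≡ {Sign.-} {Sign.+} x*y≢- = contradiction refl x*y≢-

Matrix : ℕ → ℕ → Set
Matrix n m = Fin n → Fin m → ℤ

infixl 7 _·_
_·_ : Matrix n m → Vector ℤ m → Vector ℤ n
(M · c) w = sum λ e → c e * M w e

InKernel : Matrix n m → Vector ℤ m → Set
InKernel M c = ∀ w → (M · c) w ≡ 0ℤ

-- kernel-rigid at e is IndependentOn for S = ∁ ⁅ e ⁆, and it implies IndependentOn for every proper S.
record MinimallyDependentColumns (M : Matrix n m) : Set where
  field
    dependence     : Vector ℤ m
    dependence≢0   : ∃ λ e → dependence e ≢ 0ℤ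
    dependence∈ker : InKernel M dependence
    kernel-rigid   : ∀ c → InKernel M c → ∀ e → c e ≡ 0ℤ → ∀ e′ → c e′ ≡ 0ℤ

·-congˡ : {M N : Matrix n m} → (∀ w e → M w e ≡ N w e) → ∀ c w → (M · c) w ≡ (N · c) w
·-congˡ M≗N c w = sum-cong-≗ λ e → cong (c e *_) (M≗N w e)

·-congʳ : (M : Matrix n m) {c d : Vector ℤ m} → (∀ e → c e ≡ d e) → ∀ w → (M · c) w ≡ (M · d) w
·-congʳ M c≗d w = sum-cong-≗ λ e → cong (_* M w e) (c≗d e)

minimallyDependentColumns-cong : {M N : Matrix n m} → (∀ w e → M w e ≡ N w e) →
                                 MinimallyDependentColumns M → MinimallyDependentColumns N
minimallyDependentColumns-cong M≗N md = record
  { dependence     = dependence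
  ; dependence≢0   = dependence≢0
  ; dependence∈ker = λ w → trans (sym (·-congˡ M≗N dependence w)) (dependence∈ker w)
  ; kernel-rigid   = λ c c∈ker → kernel-rigid c λ w → trans (·-congˡ M≗N c w) (c∈ker w)
  }
  where open MinimallyDependentColumns md

scaleColumns : (Fin m → Sign) → Matrix n m → Matrix n m
scaleColumns s M w e = signℤ (s e) * M w e

rescale : (Fin m → Sign) → Vector ℤ m → Vector ℤ m
rescale s c e = signℤ (s e) * c e

module _ (s : Fin m → Sign) where

  rescale-involutive : ∀ c e → rescale s (rescale s c) e ≡ c e
  rescale-involutive c e = signℤ-cancel (s e) (c e)

  rescale-≡0 : ∀ c e → c e ≡ 0ℤ → rescale s c e ≡ 0ℤ
  rescale-≡0 c e ce≡0 = trans (cong (signℤ (s e) *_) ce≡0) (ℤP.*-zeroʳ (signℤ (s e)))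

  rescale-≡0⁻¹ : ∀ c e → rescale s c e ≡ 0ℤ → c e ≡ 0ℤ
  rescale-≡0⁻¹ c e sce≡0 = trans (sym (rescale-involutive c e)) (rescale-≡0 (rescale s c) e sce≡0)

  scaleColumns-· : ∀ (M : Matrix n m) c w → (scaleColumns s M · rescale s c) w ≡ (M · c) w
  scaleColumns-· M c w = sum-cong-≗ λ e → begin
    signℤ (s e) * c e * (signℤ (s e) * M w e)
      ≡⟨ solve 3 (λ x y z → x :* y :* (x :* z) := x :* (x :* (y :* z))) refl (signℤ (s e)) (c e) (M w e) ⟩
    signℤ (s e) * (signℤ (s e) * (c e * M w e))
      ≡⟨ signℤ-cancel (s e) (c e * M w e) ⟩
    c e * M w e ∎
    where open ≡-Reasoning

  minimallyDependentColumns-scale : {M : Matrix n m} →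
    MinimallyDependentColumns M → MinimallyDependentColumns (scaleColumns s M)
  minimallyDependentColumns-scale {M = M} md = record
    { dependence     = rescale s dependence
    ; dependence≢0   = proj₁ dependence≢0 , proj₂ dependence≢0 ∘ rescale-≡0⁻¹ dependence (proj₁ dependence≢0)
    ; dependence∈ker = λ w → trans (scaleColumns-· M dependence w) (dependence∈ker w)
    ; kernel-rigid   = λ c c∈ker e ce≡0 e′ → rescale-≡0⁻¹ c e′
        (kernel-rigid (rescale s c) (rescale∈ker c c∈ker) e (rescale-≡0 c e ce≡0) e′)
    }
    where
    open MinimallyDependentColumns md
    rescale∈ker : ∀ c → InKernel (scaleColumns s M) c → InKernel M (rescale s c)
    rescale∈ker c c∈ker w = begin
      (M · rescale s c) w                              ≡⟨ scaleColumns-· M (rescale s c) w ⟨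
      (scaleColumns s M · rescale s (rescale s c)) w   ≡⟨ ·-congʳ (scaleColumns s M) (rescale-involutive c) w ⟩
      (scaleColumns s M · c) w                         ≡⟨ c∈ker w ⟩
      0ℤ                                               ∎
      where open ≡-Reasoning

mergeColumns : Matrix n (suc m) → (e₁ e₂ : Fin (suc m)) → Matrix n m
mergeColumns M e₁ e₂ w f with punchIn e₂ f ≟ e₁
... | yes _ = M w e₁ + M w e₂
... | no _  = M w (punchIn e₂ f)

module _ (M : Matrix n (suc m)) {e₁ e₂ : Fin (suc m)} (w : Fin n) {f : Fin m} where

  mergeColumns-merged : punchIn e₂ f ≡ e₁ → mergeColumns M e₁ e₂ w f ≡ M w e₁ + M w e₂
  mergeColumns-merged f↦e₁ with punchIn e₂ f ≟ e₁
  ... | yes _    = refl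
  ... | no f↦̸e₁ = contradiction f↦e₁ f↦̸e₁

  mergeColumns-other : punchIn e₂ f ≢ e₁ → mergeColumns M e₁ e₂ w f ≡ M w (punchIn e₂ f)
  mergeColumns-other f↦̸e₁ with punchIn e₂ f ≟ e₁
  ... | yes f↦e₁ = contradiction f↦e₁ f↦̸e₁
  ... | no _     = refl

module ColumnMerge {e₁ e₂ : Fin (suc m)} (e₁≢e₂ : e₁ ≢ e₂) where

  merged : Fin m
  merged = punchOut (e₁≢e₂ ∘ sym)

  punchIn-merged : punchIn e₂ merged ≡ e₁
  punchIn-merged = punchIn-punchOut (e₁≢e₂ ∘ sym)

  punchIn-unmerged : ∀ {f} → f ≢ merged → punchIn e₂ f ≢ e₁
  punchIn-unmerged {f} f≢merged f↦e₁ =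
    f≢merged (punchIn-injective e₂ f merged (trans f↦e₁ (sym punchIn-merged)))

  duplicate : Vector ℤ m → Vector ℤ (suc m)
  duplicate c = insertAt c e₂ (c merged)

  duplicate-e₁ : ∀ c → duplicate c e₁ ≡ c merged
  duplicate-e₁ c = trans (cong (duplicate c) (sym punchIn-merged)) (insertAt-punchIn c e₂ (c merged) merged)

  duplicate-e₂ : ∀ c → duplicate c e₂ ≡ c merged
  duplicate-e₂ c = insertAt-lookup c e₂ (c merged)

  mergeColumns-· : ∀ (M : Matrix n (suc m)) c w → (mergeColumns M e₁ e₂ · c) w ≡ (M · duplicate c) w
  mergeColumns-· M c w = begin
    (mergeColumns M e₁ e₂ · c) w
      ≡⟨ sum-bumpAt _ kept merged (c merged * M w e₂) at-merged off-merged ⟩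
    sum kept + c merged * M w e₂
      ≡⟨ ℤP.+-comm (sum kept) (c merged * M w e₂) ⟩
    c merged * M w e₂ + sum kept
      ≡⟨ cong₂ _+_ (cong (_* M w e₂) (duplicate-e₂ c))
                   (sum-cong-≗ λ f → cong (_* M w (punchIn e₂ f)) (insertAt-punchIn c e₂ (c merged) f)) ⟨
    duplicate c e₂ * M w e₂ + sum (λ f → duplicate c (punchIn e₂ f) * M w (punchIn e₂ f))
      ≡⟨ sum-remove {i = e₂} (λ e → duplicate c e * M w e) ⟨
    (M · duplicate c) w ∎
    where
    open ≡-Reasoning
    kept : Vector ℤ m
    kept f = c f * M w (punchIn e₂ f)
    at-merged : c merged * mergeColumns M e₁ e₂ w merged ≡ kept merged + c merged * M w e₂
    at-merged = begin
      c merged * mergeColumns M e₁ e₂ w merged  ≡⟨ cong (c merged *_) (mergeColumns-merged M w punchIn-merged) ⟩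
      c merged * (M w e₁ + M w e₂)              ≡⟨ ℤP.*-distribˡ-+ (c merged) (M w e₁) (M w e₂) ⟩
      c merged * M w e₁ + c merged * M w e₂     ≡⟨ cong (λ e → c merged * M w e + c merged * M w e₂) punchIn-merged ⟨
      kept merged + c merged * M w e₂           ∎
    off-merged : ∀ f → f ≢ merged → c f * mergeColumns M e₁ e₂ w f ≡ kept f
    off-merged f f≢merged = cong (c f *_) (mergeColumns-other M w (punchIn-unmerged f≢merged))

contract : Matrix (suc n) (suc m) → Fin (suc n) → (e₁ e₂ : Fin (suc m)) → Matrix n m
contract M v e₁ e₂ = removeAt (mergeColumns M e₁ e₂) v

module _ (M : Matrix (suc n) (suc m)) {v : Fin (suc n)} {e₁ e₂ : Fin (suc m)} (e₁≢e₂ : e₁ ≢ e₂)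
         (row-support : ∀ e → e ≢ e₁ → e ≢ e₂ → M v e ≡ 0ℤ)
         (Mve₁≢0 : M v e₁ ≢ 0ℤ) (Mve₂≡-Mve₁ : M v e₂ ≡ - M v e₁) where

  open ColumnMerge e₁≢e₂

  ·-row : ∀ c → (M · c) v ≡ (c e₁ - c e₂) * M v e₁
  ·-row c = begin
    (M · c) v
      ≡⟨ sum-remove {i = e₂} (λ e → c e * M v e) ⟩
    c e₂ * M v e₂ + sum (λ f → c (punchIn e₂ f) * M v (punchIn e₂ f))
      ≡⟨ cong (c e₂ * M v e₂ +_) (sum-single _ merged vanishes) ⟩
    c e₂ * M v e₂ + c (punchIn e₂ merged) * M v (punchIn e₂ merged)
      ≡⟨ cong₂ (λ x e → c e₂ * x + c e * M v e) Mve₂≡-Mve₁ punchIn-merged ⟩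
    c e₂ * - M v e₁ + c e₁ * M v e₁
      ≡⟨ solve 3 (λ x y a → y :* (:- a) :+ x :* a := (x :- y) :* a) refl (c e₁) (c e₂) (M v e₁) ⟩
    (c e₁ - c e₂) * M v e₁ ∎
    where
    open ≡-Reasoning
    vanishes : ∀ f → f ≢ merged → c (punchIn e₂ f) * M v (punchIn e₂ f) ≡ 0ℤ
    vanishes f f≢merged =
      trans (cong (c (punchIn e₂ f) *_) (row-support _ (punchIn-unmerged f≢merged) (punchInᵢ≢i e₂ f)))
            (ℤP.*-zeroʳ (c (punchIn e₂ f)))

  kernel-e₁≡e₂ : ∀ c → InKernel M c → c e₁ ≡ c e₂
  kernel-e₁≡e₂ c c∈ker with ℤP.i*j≡0⇒i≡0∨j≡0 (c e₁ - c e₂) (trans (sym (·-row c)) (c∈ker v))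
  ... | inj₁ diff≡0 = ℤP.i-j≡0⇒i≡j (c e₁) (c e₂) diff≡0
  ... | inj₂ Mve₁≡0 = contradiction Mve₁≡0 Mve₁≢0

  duplicate∈ker : ∀ c → InKernel (contract M v e₁ e₂) c → InKernel M (duplicate c)
  duplicate∈ker c c∈ker w with w ≟ v
  ... | yes refl = begin
    (M · duplicate c) w                         ≡⟨ ·-row (duplicate c) ⟩
    (duplicate c e₁ - duplicate c e₂) * M v e₁
      ≡⟨ cong (_* M v e₁) (ℤP.i≡j⇒i-j≡0 (trans (duplicate-e₁ c) (sym (duplicate-e₂ c)))) ⟩
    0ℤ * M v e₁                                 ≡⟨ ℤP.*-zeroˡ (M v e₁) ⟩
    0ℤ                                          ∎
    where open ≡-Reasoning
  ... | no w≢v = begin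
    (M · duplicate c) w                              ≡⟨ mergeColumns-· M c w ⟨
    (mergeColumns M e₁ e₂ · c) w                     ≡⟨ cong (mergeColumns M e₁ e₂ · c) (punchIn-punchOut (w≢v ∘ sym)) ⟨
    (contract M v e₁ e₂ · c) (punchOut (w≢v ∘ sym))  ≡⟨ c∈ker (punchOut (w≢v ∘ sym)) ⟩
    0ℤ                                               ∎
    where open ≡-Reasoning

  removeAt∈ker : ∀ c → InKernel M c → InKernel (contract M v e₁ e₂) (removeAt c e₂)
  removeAt∈ker c c∈ker u = begin
    (contract M v e₁ e₂ · removeAt c e₂) u         ≡⟨ mergeColumns-· M (removeAt c e₂) (punchIn v u) ⟩
    (M · duplicate (removeAt c e₂)) (punchIn v u)  ≡⟨ ·-congʳ M duplicate-removeAt (punchIn v u) ⟩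
    (M · c) (punchIn v u)                          ≡⟨ c∈ker (punchIn v u) ⟩
    0ℤ                                             ∎
    where
    open ≡-Reasoning
    duplicate-removeAt : ∀ e → duplicate (removeAt c e₂) e ≡ c e
    duplicate-removeAt e = trans
      (cong (λ x → insertAt (removeAt c e₂) e₂ x e) (trans (cong c punchIn-merged) (kernel-e₁≡e₂ c c∈ker)))
      (insertAt-removeAt c e₂ e)

  contract-minimallyDependentColumns :
    MinimallyDependentColumns M → MinimallyDependentColumns (contract M v e₁ e₂)
  contract-minimallyDependentColumns md = record
    { dependence     = removeAt dependence e₂
    ; dependence≢0   = merged , λ d≡0 → proj₂ dependence≢0
        (kernel-rigid dependence dependence∈ker e₁ (trans (cong dependence (sym punchIn-merged)) d≡0)
                      (proj₁ dependence≢0))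
    ; dependence∈ker = removeAt∈ker dependence dependence∈ker
    ; kernel-rigid   = λ c c∈ker f₀ cf₀≡0 f → trans (sym (insertAt-punchIn c e₂ (c merged) f))
        (kernel-rigid (duplicate c) (duplicate∈ker c c∈ker) (punchIn e₂ f₀)
                      (trans (insertAt-punchIn c e₂ (c merged) f₀) cf₀≡0) (punchIn e₂ f))
    }
    where open MinimallyDependentColumns md

module _ (G : OHG n m) where

  incMat≡sum : ∀ w e → incMat G w e ≡ sum (signℤ ∘ σ G w e)
  incMat≡sum w e = ∑ℤ≡sum (ι G w e) (signℤ ∘ σ G w e)

  combZero⇒inKernel : ∀ c → CombZero G c → InKernel (incMat G) c
  combZero⇒inKernel c c-comb w = trans (sym (∑ℤ≡sum m λ e → c e * incMat G w e)) (c-comb w)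

  inKernel⇒combZero : ∀ c → InKernel (incMat G) c → CombZero G c
  inKernel⇒combZero c c∈ker w = trans (∑ℤ≡sum m λ e → c e * incMat G w e) (c∈ker w)

  toColumns : MinimallyDependent G → MinimallyDependentColumns (incMat G)
  toColumns ((c , c≢0 , c-comb) , independent) = record
    { dependence     = c
    ; dependence≢0   = c≢0
    ; dependence∈ker = combZero⇒inKernel c c-comb
    ; kernel-rigid   = λ d d∈ker e de≡0 → independent (∁ ⁅ e ⁆) (e , x∈p⇒x∉∁p (x∈⁅x⁆ e)) d
        (λ e′ e′∉∁⁅e⁆ → subst (λ x → d x ≡ 0ℤ) (sym (x∈⁅y⁆⇒x≡y e (x∉∁p⇒x∈p e′∉∁⁅e⁆))) de≡0)
        (inKernel⇒combZero d d∈ker)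
    }

  fromColumns : MinimallyDependentColumns (incMat G) → MinimallyDependent G
  fromColumns md = (dependence , dependence≢0 , inKernel⇒combZero dependence dependence∈ker)
                 , λ S (e , e∉S) c c⊆S c-comb → kernel-rigid c (combZero⇒inKernel c c-comb) e (c⊆S e e∉S)
    where open MinimallyDependentColumns md

  incMat-absent : ∀ {w e} → ι G w e ≡ 0 → incMat G w e ≡ 0ℤ
  incMat-absent {w} {e} = go (ι G w e) (signℤ ∘ σ G w e)
    where
    go : ∀ k (f : Fin k → ℤ) → k ≡ 0 → ∑ℤ k f ≡ 0ℤ
    go .0 f refl = refl

  incMat-single : ∀ {w e} (h : ι G w e ≡ 1) → incMat G w e ≡ signℤ (σ G w e (theInc G w e h))
  incMat-single {w} {e} = go (ι G w e) (σ G w e)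
    where
    go : ∀ k (s : Fin k → Sign) (h : k ≡ 1) → ∑ℤ k (signℤ ∘ s) ≡ signℤ (s (subst Fin (sym h) zero))
    go .1 s refl = ℤP.+-identityʳ (signℤ (s zero))

module _ (H : OHG (suc n) (suc m)) (v : Fin (suc n)) (e₁ e₂ : Fin (suc m)) (u : Fin n) (f : Fin m) where

  private
    w = punchIn v u

  -- merge's orientation is defined by a case split on this very decision, so its signs can only
  -- be named by a function that splits the same way.
  mergedSigns : Fin (ι (merge H v e₁ e₂) u f) → ℤ
  mergedSigns k with punchIn e₂ f ≟ e₁
  ... | yes _ = [ signℤ ∘ σ H w e₁ , signℤ ∘ σ H w e₂ ]′ (splitAt (ι H w e₁) k)
  ... | no _  = signℤ (σ H w (punchIn e₂ f) k)

  signℤ-σ-merge : ∀ k → signℤ (σ (merge H v e₁ e₂) u f k) ≡ mergedSigns k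
  signℤ-σ-merge k with punchIn e₂ f ≟ e₁
  ... | no _ = refl
  ... | yes _ with splitAt (ι H w e₁) k
  ...   | inj₁ _ = refl
  ...   | inj₂ _ = refl

  sum-mergedSigns : sum mergedSigns ≡ contract (incMat H) v e₁ e₂ u f
  sum-mergedSigns with punchIn e₂ f ≟ e₁
  ... | yes _ = trans (sum-splitAt (ι H w e₁) (ι H w e₂) [ signℤ ∘ σ H w e₁ , signℤ ∘ σ H w e₂ ]′)
                      (sym (cong₂ _+_ (incMat≡sum H w e₁) (incMat≡sum H w e₂)))
  ... | no _  = sym (incMat≡sum H w (punchIn e₂ f))

  incMat-merge : incMat (merge H v e₁ e₂) u f ≡ contract (incMat H) v e₁ e₂ u f
  incMat-merge = trans (incMat≡sum (merge H v e₁ e₂) u f) (trans (sum-cong-≗ signℤ-σ-merge) sum-mergedSigns)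

switchSign : Fin m → Fin m → Sign
switchSign s e with e ≟ s
... | yes _ = Sign.-
... | no _  = Sign.+

switchSign-self : ∀ (s : Fin m) → switchSign s s ≡ Sign.-
switchSign-self s with s ≟ s
... | yes _  = refl
... | no s≢s = contradiction refl s≢s

switchSign-other : ∀ {s e : Fin m} → e ≢ s → switchSign s e ≡ Sign.+
switchSign-other {s = s} {e} e≢s with e ≟ s
... | yes e≡s = contradiction e≡s e≢s
... | no _    = refl

module _ (G : OHG n m) (s : Fin m) where

  σ-switchEdge : ∀ w e k → σ (switchEdge G s) w e k ≡ switchSign s e Sign.* σ G w e k
  σ-switchEdge w e k with e ≟ s
  ... | yes _ = refl
  ... | no _  = refl

  incMat-switchEdge : ∀ w e → incMat (switchEdge G s) w e ≡ scaleColumns (switchSign s) (incMat G) w e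
  incMat-switchEdge w e = begin
    incMat (switchEdge G s) w e
      ≡⟨ incMat≡sum (switchEdge G s) w e ⟩
    sum (signℤ ∘ σ (switchEdge G s) w e)
      ≡⟨ sum-cong-≗ (λ k → trans (cong signℤ (σ-switchEdge w e k)) (signℤ-* (switchSign s e) (σ G w e k))) ⟩
    sum (λ k → signℤ (switchSign s e) * signℤ (σ G w e k))
      ≡⟨ *-distribˡ-sum (signℤ (switchSign s e)) (signℤ ∘ σ G w e) ⟨
    signℤ (switchSign s e) * sum (signℤ ∘ σ G w e)
      ≡⟨ cong (signℤ (switchSign s e) *_) (incMat≡sum G w e) ⟨
    scaleColumns (switchSign s) (incMat G) w e ∎
    where open ≡-Reasoning

  switchEdge-minimallyDependent : MinimallyDependent G → MinimallyDependent (switchEdge G s)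
  switchEdge-minimallyDependent md =
    fromColumns (switchEdge G s)
      (minimallyDependentColumns-cong (λ w e → sym (incMat-switchEdge w e))
        (minimallyDependentColumns-scale (switchSign s) (toColumns G md)))

module _ (G : OHG n m) {v : Fin n} {e₁ e₂ : Fin m} (e₁≢e₂ : e₁ ≢ e₂)
         (h₁ : ι G v e₁ ≡ 1) (h₂ : ι G v e₂ ≡ 1) where

  private
    x₁ = σ G v e₁ (theInc G v e₁ h₁)
    x₂ = σ G v e₂ (theInc G v e₂ h₂)

  compatible-switchEdgeˡ : ¬ CompatiblyOriented G v e₁ e₂ h₁ h₂ →
                           CompatiblyOriented (switchEdge G e₁) v e₁ e₂ h₁ h₂
  compatible-switchEdgeˡ incompatible = begin
    σ (switchEdge G e₁) v e₁ (theInc G v e₁ h₁) Sign.* σ (switchEdge G e₁) v e₂ (theInc G v e₂ h₂)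
      ≡⟨ cong₂ Sign._*_ (σ-switchEdge G e₁ v e₁ _) (σ-switchEdge G e₁ v e₂ _) ⟩
    (switchSign e₁ e₁ Sign.* x₁) Sign.* (switchSign e₁ e₂ Sign.* x₂)
      ≡⟨ cong₂ (λ s t → (s Sign.* x₁) Sign.* (t Sign.* x₂)) (switchSign-self e₁) (switchSign-other (e₁≢e₂ ∘ sym)) ⟩
    opposite x₁ Sign.* x₂
      ≡⟨ cong (λ y → opposite y Sign.* x₂) (*≢-⇒≡ {x₁} {x₂} incompatible) ⟩
    opposite x₂ Sign.* x₂
      ≡⟨ SignP.opposite[s]*s≡- x₂ ⟩
    Sign.- ∎
    where open ≡-Reasoning

  compatible-switchEdgeʳ : ¬ CompatiblyOriented G v e₁ e₂ h₁ h₂ →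
                           CompatiblyOriented (switchEdge G e₂) v e₁ e₂ h₁ h₂
  compatible-switchEdgeʳ incompatible = begin
    σ (switchEdge G e₂) v e₁ (theInc G v e₁ h₁) Sign.* σ (switchEdge G e₂) v e₂ (theInc G v e₂ h₂)
      ≡⟨ cong₂ Sign._*_ (σ-switchEdge G e₂ v e₁ _) (σ-switchEdge G e₂ v e₂ _) ⟩
    (switchSign e₂ e₁ Sign.* x₁) Sign.* (switchSign e₂ e₂ Sign.* x₂)
      ≡⟨ cong₂ (λ s t → (s Sign.* x₁) Sign.* (t Sign.* x₂)) (switchSign-other e₁≢e₂) (switchSign-self e₂) ⟩
    x₁ Sign.* opposite x₂
      ≡⟨ cong (λ y → x₁ Sign.* opposite y) (*≢-⇒≡ {x₁} {x₂} incompatible) ⟨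
    x₁ Sign.* opposite x₁
      ≡⟨ SignP.s*opposite[s]≡- x₁ ⟩
    Sign.- ∎
    where open ≡-Reasoning

merge-minimallyDependent : ∀ (H : OHG (suc n) (suc m)) {v e₁ e₂} → degree H v ≡ 2 → e₁ ≢ e₂ →
  (h₁ : ι H v e₁ ≡ 1) (h₂ : ι H v e₂ ≡ 1) → CompatiblyOriented H v e₁ e₂ h₁ h₂ →
  MinimallyDependent H → MinimallyDependent (merge H v e₁ e₂)
merge-minimallyDependent H {v} {e₁} {e₂} deg e₁≢e₂ h₁ h₂ compatible md =
  fromColumns (merge H v e₁ e₂)
    (minimallyDependentColumns-cong (λ u f → sym (incMat-merge H v e₁ e₂ u f))
      (contract-minimallyDependentColumns (incMat H) e₁≢e₂ row-support e₁-entry≢0 e₂-entry≡-e₁-entry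
        (toColumns H md)))
  where
  open ≡-Reasoning
  row-support : ∀ e → e ≢ e₁ → e ≢ e₂ → incMat H v e ≡ 0ℤ
  row-support e e≢e₁ e≢e₂ = incMat-absent H (sum≡pair⇒others≡0 (ι H v) e₁≢e₂ e≢e₁ e≢e₂ (begin
    ℕΣ.sum (ι H v)          ≡⟨ ∑ℕ≡sum _ (ι H v) ⟨
    degree H v              ≡⟨ deg ⟩
    2                       ≡⟨ cong₂ ℕ._+_ h₁ h₂ ⟨
    ι H v e₁ ℕ.+ ι H v e₂   ∎))
  e₁-entry≢0 : incMat H v e₁ ≢ 0ℤ
  e₁-entry≢0 = signℤ≢0 (σ H v e₁ (theInc H v e₁ h₁)) ∘ trans (sym (incMat-single H h₁))
  e₂-entry≡-e₁-entry : incMat H v e₂ ≡ - incMat H v e₁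
  e₂-entry≡-e₁-entry = begin
    incMat H v e₂                          ≡⟨ incMat-single H h₂ ⟩
    signℤ (σ H v e₂ (theInc H v e₂ h₂))    ≡⟨ *≡-⇒signℤ-opposite compatible ⟩
    - signℤ (σ H v e₁ (theInc H v e₁ h₁))  ≡⟨ cong -_ (incMat-single H h₁) ⟨
    - incMat H v e₁                        ∎

mainTheorem9 : ∀ {n m : ℕ} (G : OHG (suc n) (suc m)) (v : Fin (suc n)) (e₁ e₂ : Fin (suc m))
    → degree G v ≡ 2 → e₁ ≢ e₂
    → (h₁ : ι G v e₁ ≡ 1) → (h₂ : ι G v e₂ ≡ 1) → (b : Bool)
    → MinimallyDependent G
    → MinimallyDependent (twoVertexContraction G v e₁ e₂ h₁ h₂ b)
mainTheorem9 G v e₁ e₂ deg e₁≢e₂ h₁ h₂ b md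
  with σ G v e₁ (theInc G v e₁ h₁) Sign.* σ G v e₂ (theInc G v e₂ h₂) Sign.≟ Sign.-
... | yes compatible = merge-minimallyDependent G deg e₁≢e₂ h₁ h₂ compatible md
... | no incompatible with b
...   | true  = merge-minimallyDependent (switchEdge G e₁) deg e₁≢e₂ h₁ h₂
                  (compatible-switchEdgeˡ G e₁≢e₂ h₁ h₂ incompatible) (switchEdge-minimallyDependent G e₁ md)
...   | false = merge-minimallyDependent (switchEdge G e₂) deg e₁≢e₂ h₁ h₂
                  (compatible-switchEdgeʳ G e₁≢e₂ h₁ h₂ incompatible) (switchEdge-minimallyDependent G e₂ md)
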